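{- Let $a\ge 2$, $c>0$, $d$ be integers with $d<ca$ and $\gcd(d,a)=\gcd(d,c)=1$, let $n\ge 1$, and let $\mathbf s_j=ca^{n+j}-d$ for $j\in\mathbb N$ and $S_n=\langle\{\mathbf s_j:j\in\mathbb N\}\rangle$. Assume that for some integer $m>0$ it holds that $\mathbf s_m\in\langle\{\mathbf s_j:0\le j<m\}\rangle$ but $\mathbf s_{m-1}\notin\langle\{\mathbf s_j:0\le j<m-1\}\rangle$. Then $\{\mathbf s_j:0\le j<m\}$ is the minimal generating set of $S_n$. In particular, $m=e(S_n)$.
   Context: $\mathbb N=\{0,1,2,\ldots\}$. For $A\subseteq\mathbb N$, $\langle A\rangle$ is the submonoid of $(\mathbb N,+)$ generated by $A$ (so $\langle\emptyset\rangle=\{0\}$). For a nontrivial submonoid $M$ of $\mathbb N$, the minimal generating set of $M$ is the unique generating set contained in every generating set of $M$ (its elements are the nonzero elements of $M$ that are not sums of two nonzero elements of $M$; it is finite), and $e(M)$ is its cardinality. -}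

module Defs where

open import Level using (0ℓ)
open import Data.Nat.Base using (ℕ; _+_; _*_; _^_; _≤_; _<_; s≤s; z≤n; NonZero; >-nonZero)
import Data.Nat.Properties as ℕₚ
open import Data.Integer.Base as ℤ using (ℤ; +_; ∣_∣)
import Data.Integer.Properties as ℤₚ
open import Data.Fin.Base using (Fin)
open import Data.Product.Base using (_×_; ∃-syntax; Σ-syntax)
open import Function.Bundles using (_↣_; Injection)
open import Relation.Unary using (Pred; _∈_; _⊆_; _≐_)
open import Relation.Binary.PropositionalEquality using (_≡_; sym)

data ⟨_⟩ (A : Pred ℕ 0ℓ) : Pred ℕ 0ℓ where
  gen  : ∀ {x} → x ∈ A → x ∈ ⟨ A ⟩
  zero : 0 ∈ ⟨ A ⟩
  add  : ∀ {x y} → x ∈ ⟨ A ⟩ → y ∈ ⟨ A ⟩ → x + y ∈ ⟨ A ⟩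

Generates : Pred ℕ 0ℓ → Pred ℕ 0ℓ → Set
Generates A M = ⟨ A ⟩ ≐ M

-- Being contained in every generating set determines A up to _≐_.
IsMinimalGeneratingSet : Pred ℕ 0ℓ → Pred ℕ 0ℓ → Set₁
IsMinimalGeneratingSet A M =
  Generates A M × (∀ (B : Pred ℕ 0ℓ) → Generates B M → A ⊆ B)

-- A is the image of an injection from Fin k.  The image, rather than the type
-- Σ ℕ A, is compared with Fin k because A x may have several proofs.
HasCardinality : Pred ℕ 0ℓ → ℕ → Set
HasCardinality A k =
  Σ[ f ∈ Fin k ↣ ℕ ] A ≐ (λ x → ∃[ i ] Injection.to f i ≡ x)

-- The relation k = e(M).
EmbeddingDimension : Pred ℕ 0ℓ → ℕ → Set₁
EmbeddingDimension M k =
  ∃[ A ] IsMinimalGeneratingSet A M × HasCardinality A k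

-- The natural number c aⁿ⁺ʲ − d.  The absolute value only serves to land in ℕ:
-- by s-spec it changes nothing when a ≥ 2 and d < c a.
s : (a c : ℕ) (d : ℤ) (n j : ℕ) → ℕ
s a c d n j = ∣ + (c * a ^ (n + j)) ℤ.- d ∣

s-spec : ∀ {a c d n} → 2 ≤ a → d ℤ.< + (c * a) → 1 ≤ n →
         ∀ j → + s a c d n j ≡ + (c * a ^ (n + j)) ℤ.- d
s-spec {a} {c} {d} {n} 2≤a d<ca 1≤n j =
  ℤₚ.0≤i⇒+∣i∣≡i (ℤₚ.i≤j⇒0≤j-i (ℤₚ.≤-trans (ℤₚ.<⇒≤ d<ca) (ℤ.+≤+ (ℕₚ.*-monoʳ-≤ c a≤aⁿ⁺ʲ))))
  where
  instance
    a≢0 : NonZero a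
    a≢0 = >-nonZero (ℕₚ.≤-trans (s≤s z≤n) 2≤a)

  a≤aⁿ⁺ʲ : a ≤ a ^ (n + j)
  a≤aⁿ⁺ʲ = ℕₚ.≤-trans (ℕₚ.≤-reflexive (sym (ℕₚ.^-identityʳ a)))
                      (ℕₚ.^-monoʳ-≤ a (ℕₚ.≤-trans 1≤n (ℕₚ.m≤m+n n j)))

sAll : (a c : ℕ) (d : ℤ) (n : ℕ) → Pred ℕ 0ℓ
sAll a c d n x = ∃[ j ] s a c d n j ≡ x

sBelow : (a c : ℕ) (d : ℤ) (n m : ℕ) → Pred ℕ 0ℓ
sBelow a c d n m x = ∃[ j ] j < m × s a c d n j ≡ x

S : (a c : ℕ) (d : ℤ) (n : ℕ) → Pred ℕ 0ℓ
S a c d n = ⟨ sAll a c d n ⟩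

{-# OPTIONS --safe #-}

-- The recurrence s (j+1) = a s j + (a − 1) d turns a decomposition s k = s i + r
-- into s (k+1) = s (i+1) + a r.  Hence once s m lies in the monoid generated by
-- its predecessors, so do all later terms.  Contrapositively, no s i with i < m is
-- generated by its predecessors; as s is increasing, such an s i is not a sum of
-- two nonzero elements of S n, so every generating set contains it.
module Submission where

open import Defs
open import Level using (0ℓ)
open import Data.Nat.Base using (ℕ; zero; suc; _+_; _*_; _∸_; _^_; _≤_; _<_; z≤n; s≤s; s≤s⁻¹; NonZero; >-nonZero)
open import Data.Nat.Properties as ℕₚ using (_≟_)
open import Data.Nat.Tactic.RingSolver using (solve-∀)
open import Data.Integer.Base as ℤ using (ℤ; +_; 1ℤ)
import Data.Integer.Properties as ℤₚ
import Data.Integer.Tactic.RingSolver as ℤ-Ring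
open import Data.Integer.GCD using (gcd)
open import Data.Fin.Base using (toℕ; fromℕ<)
open import Data.Fin.Properties using (toℕ<n; toℕ-injective; toℕ-fromℕ<)
open import Data.Product.Base using (_×_; _,_; proj₁; proj₂; ∃-syntax)
open import Data.Sum.Base using (inj₁; inj₂)
open import Data.Empty using (⊥-elim)
open import Function.Base using (_∘_)
open import Function.Bundles using (mk↣)
open import Relation.Binary using (tri<; tri≈; tri>)
open import Relation.Nullary using (yes; no)
open import Relation.Unary using (Pred; _∈_; _∉_; _⊆_)
open import Relation.Binary.PropositionalEquality using (_≡_; _≢_; refl; sym; trans; cong; cong₂; subst; module ≡-Reasoning)

⟨⟩-elim : ∀ {A B : Pred ℕ 0ℓ} → A ⊆ ⟨ B ⟩ → ⟨ A ⟩ ⊆ ⟨ B ⟩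
⟨⟩-elim A⊆ (gen x∈A) = A⊆ x∈A
⟨⟩-elim A⊆ zero      = zero
⟨⟩-elim A⊆ (add p q) = add (⟨⟩-elim A⊆ p) (⟨⟩-elim A⊆ q)

⟨⟩-* : ∀ {A x} k → x ∈ ⟨ A ⟩ → k * x ∈ ⟨ A ⟩
⟨⟩-* zero    p = zero
⟨⟩-* (suc k) p = add p (⟨⟩-* k p)

-- Descend into the leftmost nonzero summand until a generator is reached; every summand passed on
-- its right goes into `r`.
⟨⟩-split : ∀ {A x} → x ∈ ⟨ A ⟩ → x ≢ 0 →
           ∃[ g ] ∃[ r ] g ∈ A × r ∈ ⟨ A ⟩ × x ≡ g + r
⟨⟩-split (gen {x} x∈A) _ = x , 0 , x∈A , zero , sym (ℕₚ.+-identityʳ x)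
⟨⟩-split zero x≢0 = ⊥-elim (x≢0 refl)
⟨⟩-split (add {x} {y} p q) x+y≢0 with x ≟ 0
... | yes refl = ⟨⟩-split q x+y≢0
... | no x≢0 =
  let g , r , g∈A , r∈ , x≡g+r = ⟨⟩-split p x≢0
  in g , r + y , g∈A , add r∈ q , trans (cong (_+ y) x≡g+r) (ℕₚ.+-assoc g r y)

Irreducible : Pred ℕ 0ℓ → Pred ℕ 0ℓ
Irreducible M z = z ≢ 0 × (∀ {x y} → x ∈ M → y ∈ M → x ≢ 0 → y ≢ 0 → x + y ≢ z)

-- At each `add` node one summand must be 0, since both lie in `M`. The other summand is then still
-- `z`, and following it down ends at a `gen` leaf.
irreducible⇒generator : ∀ {B M z} → Generates B M → Irreducible M z → z ∈ ⟨ B ⟩ → z ∈ B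
irreducible⇒generator _ _ (gen z∈B) = z∈B
irreducible⇒generator _ (z≢0 , _) zero = ⊥-elim (z≢0 refl)
irreducible⇒generator {B} gB irr@(_ , noSum) (add {x} {y} p q) with x ≟ 0 | y ≟ 0
... | yes refl | _        = irreducible⇒generator gB irr q
... | no _     | yes refl =
  subst B (sym (ℕₚ.+-identityʳ x))
    (irreducible⇒generator gB (subst (Irreducible _) (ℕₚ.+-identityʳ x) irr) p)
... | no x≢0   | no y≢0   = ⊥-elim (noSum (proj₁ gB p) (proj₁ gB q) x≢0 y≢0 refl)

-- The argument needs only three properties of the sequence. `t-shift` says that
-- `t (suc j) - a * t j` does not depend on `j`; it is written without subtraction because this
-- constant may be negative.
module Sequence
  (t : ℕ → ℕ) (a : ℕ)
  (t≢0 : ∀ j → t j ≢ 0)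
  (t-step : ∀ j → t j < t (suc j))
  (t-shift : ∀ i j → t (suc i) + a * t j ≡ a * t i + t (suc j))
  where

  All : Pred ℕ 0ℓ
  All x = ∃[ j ] t j ≡ x

  Below : ℕ → Pred ℕ 0ℓ
  Below m x = ∃[ j ] j < m × t j ≡ x

  t-mono-< : ∀ {i j} → i < j → t i < t j
  t-mono-< {i} {suc j} i<1+j with ℕₚ.m≤n⇒m<n∨m≡n (s≤s⁻¹ i<1+j)
  ... | inj₁ i<j  = ℕₚ.<-trans (t-mono-< i<j) (t-step j)
  ... | inj₂ refl = t-step j

  t-cancel-< : ∀ {i j} → t i < t j → i < j
  t-cancel-< {i} {j} ti<tj with ℕₚ.<-cmp i j
  ... | tri< i<j _ _  = i<j
  ... | tri≈ _ refl _ = ⊥-elim (ℕₚ.<-irrefl refl ti<tj)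
  ... | tri> _ _ j<i  = ⊥-elim (ℕₚ.<-asym ti<tj (t-mono-< j<i))

  t-injective : ∀ {i j} → t i ≡ t j → i ≡ j
  t-injective {i} {j} ti≡tj with ℕₚ.<-cmp i j
  ... | tri< i<j _ _ = ⊥-elim (ℕₚ.<-irrefl ti≡tj (t-mono-< i<j))
  ... | tri≈ _ i≡j _ = i≡j
  ... | tri> _ _ j<i = ⊥-elim (ℕₚ.<-irrefl (sym ti≡tj) (t-mono-< j<i))

  Below-mono : ∀ {i m} → i ≤ m → Below i ⊆ Below m
  Below-mono i≤m (j , j<i , eq) = j , ℕₚ.<-≤-trans j<i i≤m , eq

  -- Multiply the decomposition by `a` and add the constant of `t-shift`: the term `t i` absorbs it
  -- and becomes `t (suc i)`. The common term `a * t i` is cancelled at the end to stay in ℕ.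
  successor-decomposition : ∀ i k {r} → t k ≡ t i + r → t (suc k) ≡ t (suc i) + a * r
  successor-decomposition i k {r} eq = ℕₚ.+-cancelˡ-≡ (a * t i) _ _ (begin
    a * t i + t (suc k)         ≡⟨ t-shift i k ⟨
    t (suc i) + a * t k         ≡⟨ cong (λ x → t (suc i) + a * x) eq ⟩
    t (suc i) + a * (t i + r)   ≡⟨ rearrange a (t i) (t (suc i)) r ⟩
    a * t i + (t (suc i) + a * r) ∎)
    where
    open ≡-Reasoning
    rearrange : ∀ a x y r → y + a * (x + r) ≡ a * x + (y + a * r)
    rearrange = solve-∀

  module _ {m} (tm∈ : t m ∈ ⟨ Below m ⟩) where

    t∈⟨Below⟩-≤ : ∀ {j} → j ≤ m → t j ∈ ⟨ Below m ⟩
    t∈⟨Below⟩-≤ j≤m with ℕₚ.m≤n⇒m<n∨m≡n j≤m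
    ... | inj₁ j<m  = gen (_ , j<m , refl)
    ... | inj₂ refl = tm∈

    t∈⟨Below⟩ : ∀ j → t j ∈ ⟨ Below m ⟩
    t∈⟨Below⟩ zero    = t∈⟨Below⟩-≤ z≤n
    t∈⟨Below⟩ (suc k) with ⟨⟩-split (t∈⟨Below⟩ k) (t≢0 k)
    ... | _ , r , (i , i<m , refl) , r∈ , eq =
      -- The shifted index `suc i` is at most `m`, and the boundary case `suc i ≡ m` is where `tm∈`
      -- enters.
      subst ⟨ Below m ⟩ (sym (successor-decomposition i k eq))
        (add (t∈⟨Below⟩-≤ i<m) (⟨⟩-* a r∈))

  -- No generator in a sum exceeds the total, so each one used is below `t i` and, by monotonicity,
  -- has index below `i`.
  <t⇒∈⟨Below⟩ : ∀ {x i} → x ∈ ⟨ All ⟩ → x < t i → x ∈ ⟨ Below i ⟩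
  <t⇒∈⟨Below⟩ (gen (j , refl)) x<ti = gen (j , t-cancel-< x<ti , refl)
  <t⇒∈⟨Below⟩ zero _ = zero
  <t⇒∈⟨Below⟩ (add {x} {y} p q) x+y<ti =
    add (<t⇒∈⟨Below⟩ p (ℕₚ.≤-<-trans (ℕₚ.m≤m+n x y) x+y<ti))
        (<t⇒∈⟨Below⟩ q (ℕₚ.≤-<-trans (ℕₚ.m≤n+m y x) x+y<ti))

  -- Two nonzero summands of `t i` are both strictly smaller than `t i`, so they, and hence `t i`
  -- itself, would lie in `⟨ Below i ⟩`.
  t-irreducible : ∀ {i} → t i ∉ ⟨ Below i ⟩ → Irreducible ⟨ All ⟩ (t i)
  t-irreducible {i} ti∉ = t≢0 i , λ {x} {y} x∈ y∈ x≢0 y≢0 x+y≡ti →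
    ti∉ (subst ⟨ Below i ⟩ x+y≡ti (add
      (<t⇒∈⟨Below⟩ x∈ (subst (x <_) x+y≡ti (ℕₚ.m<m+n x (ℕₚ.n≢0⇒n>0 y≢0))))
      (<t⇒∈⟨Below⟩ y∈ (subst (y <_) x+y≡ti (ℕₚ.m<n+m y (ℕₚ.n≢0⇒n>0 x≢0))))))

  Below-minimal : ∀ m → t (suc m) ∈ ⟨ Below (suc m) ⟩ → t m ∉ ⟨ Below m ⟩ →
                  IsMinimalGeneratingSet (Below (suc m)) ⟨ All ⟩
  Below-minimal m t∈ t∉ = generates , minimal
    where
    generates : Generates (Below (suc m)) ⟨ All ⟩
    generates = ⟨⟩-elim (λ (j , _ , eq) → gen (j , eq))
              , ⟨⟩-elim (λ { (j , refl) → t∈⟨Below⟩ t∈ j })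

    minimal : ∀ B → Generates B ⟨ All ⟩ → Below (suc m) ⊆ B
    minimal B gB (i , i<1+m , refl) =
      irreducible⇒generator gB (t-irreducible ti∉) (proj₂ gB (gen (i , refl)))
      where
      ti∉ : t i ∉ ⟨ Below i ⟩
      -- Here `i` plays the role of the stopping index: `ti∈` puts every term, in particular `t m`,
      -- into `⟨ Below i ⟩`, and `i ≤ m` contradicts `t∉`.
      ti∉ ti∈ = t∉ (⟨⟩-elim (gen ∘ Below-mono (s≤s⁻¹ i<1+m)) (t∈⟨Below⟩ ti∈ m))

  Below-cardinality : ∀ m → HasCardinality (Below m) m
  Below-cardinality m =
      mk↣ {to = t ∘ toℕ} (toℕ-injective ∘ t-injective)
    , (λ (j , j<m , eq) → fromℕ< j<m , trans (cong t (toℕ-fromℕ< j<m)) eq)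
    , (λ (i , eq) → toℕ i , toℕ<n i , eq)

module _ {a c d n} (2≤a : 2 ≤ a) (0<c : 0 < c) (d<ca : d ℤ.< + (c * a)) (1≤n : 1 ≤ n) where

  private
    instance
      a≢0 : NonZero a
      a≢0 = >-nonZero (ℕₚ.≤-trans (s≤s z≤n) 2≤a)

      c≢0 : NonZero c
      c≢0 = >-nonZero 0<c

    spec : ∀ j → + s a c d n j ≡ + (c * a ^ (n + j)) ℤ.- d
    spec = s-spec {c = c} 2≤a d<ca 1≤n

    top-suc : ∀ j → c * a ^ (n + suc j) ≡ a * (c * a ^ (n + j))
    top-suc j = trans (cong (λ e → c * a ^ e) (ℕₚ.+-suc n j)) (swap c a (a ^ (n + j)))
      where
      swap : ∀ c a p → c * (a * p) ≡ a * (c * p)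
      swap = solve-∀

    -- Pulling out the factor `a` lets the ring solver treat `c * a ^ (n + j)` as an atom in
    -- `s-shift`.
    spec-suc : ∀ j → + s a c d n (suc j) ≡ + a ℤ.* + (c * a ^ (n + j)) ℤ.- d
    spec-suc j = trans (spec (suc j))
      (cong (ℤ._- d) (trans (cong +_ (top-suc j)) (ℤₚ.pos-* a _)))

  -- A zero term would force `d` to equal `c * a ^ (n + j)`, which is at least `c * a` and so
  -- exceeds `d`.
  s≢0 : ∀ j → s a c d n j ≢ 0
  s≢0 j s≡0 = ℤₚ.<-irrefl (sym top≡d) (ℤₚ.<-≤-trans d<ca (ℤ.+≤+ (ℕₚ.*-monoʳ-≤ c a≤aⁿ⁺ʲ)))
    where
    top≡d : + (c * a ^ (n + j)) ≡ d
    top≡d = ℤₚ.i-j≡0⇒i≡j _ d (ℤₚ.∣i∣≡0⇒i≡0 s≡0)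

    a≤aⁿ⁺ʲ : a ≤ a ^ (n + j)
    a≤aⁿ⁺ʲ = subst (_≤ a ^ (n + j)) (ℕₚ.^-identityʳ a)
               (ℕₚ.^-monoʳ-≤ a (ℕₚ.m≤n⇒m≤n+o j 1≤n))

  s-step : ∀ j → s a c d n j < s a c d n (suc j)
  s-step j = ℤₚ.drop‿+<+ (begin-strict
    + s a c d n j                 ≡⟨ spec j ⟩
    + (c * a ^ (n + j)) ℤ.- d     <⟨ ℤₚ.+-monoˡ-< (ℤ.- d) (ℤ.+<+ (ℕₚ.*-monoʳ-< c
                                       (ℕₚ.^-monoʳ-< a 2≤a (ℕₚ.+-monoʳ-< n (ℕₚ.n<1+n j))))) ⟩
    + (c * a ^ (n + suc j)) ℤ.- d ≡⟨ spec (suc j) ⟨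
    + s a c d n (suc j)           ∎)
    where open ℤₚ.≤-Reasoning

  -- With `p k` for `c * a ^ (n + k)`, both sides equal `a (p i + p j) - (a + 1) d`. The computation
  -- runs in ℤ, where `d` lives.
  s-shift : ∀ i j → s a c d n (suc i) + a * s a c d n j ≡ a * s a c d n i + s a c d n (suc j)
  s-shift i j = ℤₚ.+-injective (begin
    + (s' (suc i) + a * s' j)                 ≡⟨ ℤₚ.pos-+ (s' (suc i)) _ ⟩
    + s' (suc i) ℤ.+ + (a * s' j)             ≡⟨ cong (ℤ._+_ (+ s' (suc i))) (ℤₚ.pos-* a _) ⟩
    + s' (suc i) ℤ.+ + a ℤ.* + s' j           ≡⟨ cong₂ (λ x y → x ℤ.+ + a ℤ.* y) (spec-suc i) (spec j) ⟩
    (+ a ℤ.* p i ℤ.- d) ℤ.+ + a ℤ.* (p j ℤ.- d) ≡⟨ exchange (+ a) (p i) (p j) d ⟩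
    + a ℤ.* (p i ℤ.- d) ℤ.+ (+ a ℤ.* p j ℤ.- d) ≡⟨ cong₂ (λ x y → + a ℤ.* x ℤ.+ y) (spec i) (spec-suc j) ⟨
    + a ℤ.* + s' i ℤ.+ + s' (suc j)           ≡⟨ cong (ℤ._+ + s' (suc j)) (ℤₚ.pos-* a _) ⟨
    + (a * s' i) ℤ.+ + s' (suc j)             ≡⟨ ℤₚ.pos-+ (a * s' i) _ ⟨
    + (a * s' i + s' (suc j))                 ∎)
    where
    open ≡-Reasoning
    s' : ℕ → ℕ
    s' = s a c d n
    p : ℕ → ℤ
    p k = + (c * a ^ (n + k))
    exchange : ∀ a p q d → (a ℤ.* p ℤ.- d) ℤ.+ a ℤ.* (q ℤ.- d) ≡ a ℤ.* (p ℤ.- d) ℤ.+ (a ℤ.* q ℤ.- d)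
    exchange = ℤ-Ring.solve-∀

theorem3p2 : ∀ (a c : ℕ) (d : ℤ) (n : ℕ) →
    2 ≤ a → 0 < c → d ℤ.< + (c * a) →
    gcd d (+ a) ≡ 1ℤ → gcd d (+ c) ≡ 1ℤ → 1 ≤ n →
    ∀ (m : ℕ) → 0 < m →
    s a c d n m ∈ ⟨ sBelow a c d n m ⟩ →
    s a c d n (m ∸ 1) ∉ ⟨ sBelow a c d n (m ∸ 1) ⟩ →
    IsMinimalGeneratingSet (sBelow a c d n m) (S a c d n) ×
    EmbeddingDimension (S a c d n) m
theorem3p2 a c d n 2≤a 0<c d<ca _ _ 1≤n (suc m) _ s∈ s∉ =
  minimal , _ , minimal , Below-cardinality (suc m)
  where
  -- For this sequence `All` and `Below` unfold to `sAll` and `sBelow`, and matching on `suc m` has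
  -- reduced `m ∸ 1`, so the hypotheses fit as they are.
  open Sequence (s a c d n) a (s≢0 2≤a 0<c d<ca 1≤n)
         (s-step 2≤a 0<c d<ca 1≤n) (s-shift 2≤a 0<c d<ca 1≤n)

  minimal : IsMinimalGeneratingSet (sBelow a c d n (suc m)) (S a c d n)
  minimal = Below-minimal m s∈ s∉
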